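{- The rule $\mathsf{Cut}$ is admissible in $\mathsf{G}_{\mathsf{bMDL}}\mathsf{Con}\mathsf{W}$: for all sequents $\Gamma \Rightarrow \varphi,\Delta$ and $\Sigma,\varphi\Rightarrow\Pi$, if both are derivable in the calculus $\mathsf{G}_{\mathsf{bMDL}}$ extended with Weakening and left and right Contraction, then so is $\Gamma,\Sigma\Rightarrow\Delta,\Pi$.
   Context: Formulae are built from propositional variables and $\bot$ using the classical connectives $\neg,\land,\lor,\to$, a unary modality $\Box$ and a binary modality $\mathcal{O}(\cdot/\cdot)$. A sequent $\Gamma\Rightarrow\Delta$ is a pair of finite multisets of formulae. $\Gamma^{\Box}$ denotes the multiset obtained from $\Gamma$ by deleting every occurrence of a formula not of the form $\Box\varphi$. The calculus $\mathsf{G}_{\mathsf{bMDL}}$ has initial sequents $\Gamma,\varphi\Rightarrow\varphi,\Delta$, the zero-premiss rule $\Gamma,\bot\Rightarrow\Delta$, and the following rules. Propositional rules (principal formula copied into the premisses): ($\neg L$) from $\Gamma,\neg\varphi\Rightarrow\varphi,\Delta$ infer $\Gamma,\neg\varphi\Rightarrow\Delta$; ($\neg R$) from $\Gamma,\varphi\Rightarrow\neg\varphi,\Delta$ infer $\Gamma\Rightarrow\neg\varphi,\Delta$; ($\land L$) from $\Gamma,\varphi\land\psi,\varphi,\psi\Rightarrow\Delta$ infer $\Gamma,\varphi\land\psi\Rightarrow\Delta$; ($\land R$) from $\Gamma\Rightarrow\varphi\land\psi,\varphi,\Delta$ and $\Gamma\Rightarrow\varphi\land\psi,\psi,\Delta$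 infer $\Gamma\Rightarrow\varphi\land\psi,\Delta$; ($\lor L$) from $\Gamma,\varphi\lor\psi,\varphi\Rightarrow\Delta$ and $\Gamma,\varphi\lor\psi,\psi\Rightarrow\Delta$ infer $\Gamma,\varphi\lor\psi\Rightarrow\Delta$; ($\lor R$) from $\Gamma\Rightarrow\varphi\lor\psi,\varphi,\psi,\Delta$ infer $\Gamma\Rightarrow\varphi\lor\psi,\Delta$; ($\to L$) from $\Gamma,\varphi\to\psi\Rightarrow\varphi,\Delta$ and $\Gamma,\varphi\to\psi,\psi\Rightarrow\Delta$ infer $\Gamma,\varphi\to\psi\Rightarrow\Delta$; ($\to R$) from $\Gamma,\varphi\Rightarrow\varphi\to\psi,\psi,\Delta$ infer $\Gamma\Rightarrow\varphi\to\psi,\Delta$. Modal rules: ($\mathsf{4}$) from $\Gamma^{\Box}\Rightarrow\varphi$ infer $\Gamma\Rightarrow\Box\varphi,\Delta$; ($\mathsf{T}$) from $\Gamma,\Box\varphi,\varphi\Rightarrow\Delta$ infer $\Gamma,\Box\varphi\Rightarrow\Delta$; ($\mathsf{Mon}$) from $\Gamma^{\Box},\varphi\Rightarrow\theta$, $\Gamma^{\Box},\psi\Rightarrow\chi$ and $\Gamma^{\Box},\chi\Rightarrow\psi$ infer $\Gamma,\mathcal{O}(\varphi/\psi)\Rightarrow\mathcal{O}(\theta/\chi),\Delta$; ($\mathsf{D}_1$) from $\Gamma^{\Box},\varphi\Rightarrow$ infer $\Gamma,\mathcal{O}(\varphi/\psi)\Rightarrow\Delta$; ($\mathsf{D}_2$)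 from $\Gamma^{\Box},\varphi,\theta\Rightarrow$, $\Gamma^{\Box},\psi\Rightarrow\chi$ and $\Gamma^{\Box},\chi\Rightarrow\psi$ infer $\Gamma,\mathcal{O}(\varphi/\psi),\mathcal{O}(\theta/\chi)\Rightarrow\Delta$. Structural rules: ($\mathsf{W}$) from $\Gamma\Rightarrow\Delta$ infer $\Gamma,\Sigma\Rightarrow\Delta,\Pi$; ($\mathsf{Con}_L$) from $\Gamma,\varphi,\varphi\Rightarrow\Delta$ infer $\Gamma,\varphi\Rightarrow\Delta$; ($\mathsf{Con}_R$) from $\Gamma\Rightarrow\varphi,\varphi,\Delta$ infer $\Gamma\Rightarrow\varphi,\Delta$; ($\mathsf{Cut}$) from $\Gamma\Rightarrow\varphi,\Delta$ and $\Sigma,\varphi\Rightarrow\Pi$ infer $\Gamma,\Sigma\Rightarrow\Delta,\Pi$. $\mathsf{G}_{\mathsf{bMDL}}\mathsf{Con}\mathsf{W}$ is $\mathsf{G}_{\mathsf{bMDL}}$ extended with $\mathsf{Con}_L$, $\mathsf{Con}_R$ and $\mathsf{W}$. -}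

module Defs where

open import Data.List.Base using (List; []; _∷_; [_]; _++_; filter)
open import Data.List.Relation.Binary.Permutation.Propositional using (_↭_)
open import Data.List.Relation.Unary.All using (All)
open import Data.Nat.Base using (ℕ)
open import Relation.Binary.Construct.Union using (_∪_)
open import Relation.Binary.Core using (REL)
open import Relation.Nullary.Decidable.Core using (yes; no)
open import Relation.Unary using (Decidable)
open import Level using (0ℓ)

infix  9 ¬_ □_
infixr 8 _∧_
infixr 7 _∨_
infixr 6 _⊃_
infix  4 _⇒_
infix  3 _⊢_

data Formula : Set where
  var     : ℕ → Formula
  ⊥       : Formula
  ¬_      : Formula → Formula
  _∧_     : Formula → Formula → Formula
  _∨_     : Formula → Formula → Formula
  _⊃_     : Formula → Formula → Formula
  □_      : Formula → Formula
  𝒪[_/_]  : Formula → Formula → Formula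

-- Finite multisets are represented by lists considered up to permutation;
-- the constructor `perm` of _⊢_ makes derivability respect this.
record Sequent : Set where
  constructor _⇒_
  field
    antecedent succedent : List Formula

data Boxed : Formula → Set where
  boxed : ∀ φ → Boxed (□ φ)

boxed? : Decidable Boxed
boxed? (var _)    = no λ ()
boxed? ⊥          = no λ ()
boxed? (¬ _)      = no λ ()
boxed? (_ ∧ _)    = no λ ()
boxed? (_ ∨ _)    = no λ ()
boxed? (_ ⊃ _)    = no λ ()
boxed? (□ φ)      = yes (boxed φ)
boxed? 𝒪[ _ / _ ] = no λ ()

infix 10 _^□

_^□ : List Formula → List Formula
Γ ^□ = filter boxed? Γ

-- R ps c holds when c is inferred from the list of premisses ps by an
-- instance of one of the rules in R.
Rules : Set₁
Rules = REL (List Sequent) Sequent 0ℓ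

data _⊢_ (R : Rules) : Sequent → Set where
  rule : ∀ {ps c} → R ps c → All (R ⊢_) ps → R ⊢ c
  perm : ∀ {Γ Γ′ Δ Δ′} → Γ ↭ Γ′ → Δ ↭ Δ′ → R ⊢ Γ ⇒ Δ → R ⊢ Γ′ ⇒ Δ′

data GbMDL : Rules where
  init : ∀ {Γ Δ φ} → GbMDL [] (φ ∷ Γ ⇒ φ ∷ Δ)
  ⊥L   : ∀ {Γ Δ} → GbMDL [] (⊥ ∷ Γ ⇒ Δ)

  ¬L   : ∀ {Γ Δ φ} →
         GbMDL [ ¬ φ ∷ Γ ⇒ φ ∷ Δ ]
               (¬ φ ∷ Γ ⇒ Δ)
  ¬R   : ∀ {Γ Δ φ} →
         GbMDL [ φ ∷ Γ ⇒ ¬ φ ∷ Δ ]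
               (Γ ⇒ ¬ φ ∷ Δ)
  ∧L   : ∀ {Γ Δ φ ψ} →
         GbMDL [ φ ∧ ψ ∷ φ ∷ ψ ∷ Γ ⇒ Δ ]
               (φ ∧ ψ ∷ Γ ⇒ Δ)
  ∧R   : ∀ {Γ Δ φ ψ} →
         GbMDL ((Γ ⇒ φ ∧ ψ ∷ φ ∷ Δ) ∷ (Γ ⇒ φ ∧ ψ ∷ ψ ∷ Δ) ∷ [])
               (Γ ⇒ φ ∧ ψ ∷ Δ)
  ∨L   : ∀ {Γ Δ φ ψ} →
         GbMDL ((φ ∨ ψ ∷ φ ∷ Γ ⇒ Δ) ∷ (φ ∨ ψ ∷ ψ ∷ Γ ⇒ Δ) ∷ [])
               (φ ∨ ψ ∷ Γ ⇒ Δ)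
  ∨R   : ∀ {Γ Δ φ ψ} →
         GbMDL [ Γ ⇒ φ ∨ ψ ∷ φ ∷ ψ ∷ Δ ]
               (Γ ⇒ φ ∨ ψ ∷ Δ)
  ⊃L   : ∀ {Γ Δ φ ψ} →
         GbMDL ((φ ⊃ ψ ∷ Γ ⇒ φ ∷ Δ) ∷ (φ ⊃ ψ ∷ ψ ∷ Γ ⇒ Δ) ∷ [])
               (φ ⊃ ψ ∷ Γ ⇒ Δ)
  ⊃R   : ∀ {Γ Δ φ ψ} →
         GbMDL [ φ ∷ Γ ⇒ φ ⊃ ψ ∷ ψ ∷ Δ ]
               (Γ ⇒ φ ⊃ ψ ∷ Δ)

  𝟒    : ∀ {Γ Δ φ} →
         GbMDL [ Γ ^□ ⇒ [ φ ] ]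
               (Γ ⇒ □ φ ∷ Δ)
  T    : ∀ {Γ Δ φ} →
         GbMDL [ □ φ ∷ φ ∷ Γ ⇒ Δ ]
               (□ φ ∷ Γ ⇒ Δ)
  Mon  : ∀ {Γ Δ φ ψ θ χ} →
         GbMDL ((φ ∷ Γ ^□ ⇒ [ θ ]) ∷ (ψ ∷ Γ ^□ ⇒ [ χ ]) ∷ (χ ∷ Γ ^□ ⇒ [ ψ ]) ∷ [])
               (𝒪[ φ / ψ ] ∷ Γ ⇒ 𝒪[ θ / χ ] ∷ Δ)
  D₁   : ∀ {Γ Δ φ ψ} →
         GbMDL [ φ ∷ Γ ^□ ⇒ [] ]
               (𝒪[ φ / ψ ] ∷ Γ ⇒ Δ)
  D₂   : ∀ {Γ Δ φ ψ θ χ} →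
         GbMDL ((φ ∷ θ ∷ Γ ^□ ⇒ []) ∷ (ψ ∷ Γ ^□ ⇒ [ χ ]) ∷ (χ ∷ Γ ^□ ⇒ [ ψ ]) ∷ [])
               (𝒪[ φ / ψ ] ∷ 𝒪[ θ / χ ] ∷ Γ ⇒ Δ)

data Contraction : Rules where
  ConL : ∀ {Γ Δ φ} → Contraction [ φ ∷ φ ∷ Γ ⇒ Δ ] (φ ∷ Γ ⇒ Δ)
  ConR : ∀ {Γ Δ φ} → Contraction [ Γ ⇒ φ ∷ φ ∷ Δ ] (Γ ⇒ φ ∷ Δ)

data Weakening : Rules where
  W : ∀ {Γ Δ Σ Π} → Weakening [ Γ ⇒ Δ ] (Γ ++ Σ ⇒ Δ ++ Π)

data Cut : Rules where
  cut : ∀ {Γ Δ Σ Π φ} →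
        Cut ((Γ ⇒ φ ∷ Δ) ∷ (φ ∷ Σ ⇒ Π) ∷ []) (Γ ++ Σ ⇒ Δ ++ Π)

GbMDLConW : Rules
GbMDLConW = GbMDL ∪ (Contraction ∪ Weakening)

Admissible : Rules → Rules → Set
Admissible S R = ∀ {ps c} → S ps c → All (R ⊢_) ps → R ⊢ c

{-# OPTIONS --safe #-}
-- Read both sides of a sequent as sets; weakening and contraction then become
-- monotonicity in _⊆_, which is absorbed into the cut. Cut is proved by the
-- lexicographic induction on (cut formula, left derivation, right derivation):
-- descend the left derivation until the cut formula is principal there, cut it
-- out of the premisses of that step, then descend the right derivation carrying
-- those premisses along, and where the cut formula is principal on both sides
-- replace the cut by cuts on its immediate subformulae.
module Submission where

open import Data.List.Base using (List; []; _∷_; [_]; _++_)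
open import Data.List.Membership.Propositional using (_∈_)
open import Data.List.Membership.Propositional.Properties
  using (∈-∃++; ∈-filter⁺; ∈-filter⁻)
open import Data.List.Properties using (++-identityʳ)
open import Data.List.Relation.Binary.Permutation.Propositional
  using (_↭_; ↭-refl; ↭-reflexive; ↭-sym; ↭-swap; prep)
open import Data.List.Relation.Binary.Permutation.Propositional.Properties
  using (shift; ++-comm; ∈-resp-↭)
open import Data.List.Relation.Binary.Subset.Propositional using (_⊆_)
open import Data.List.Relation.Binary.Subset.Propositional.Properties
  using (xs⊆xs++ys; xs⊆ys++xs; ∷⁺ʳ; ∈-∷⁺ʳ; ++⁺ʳ; filter-⊆; filter⁺′)
open import Data.List.Relation.Unary.All using ([]; _∷_)
open import Data.List.Relation.Unary.Any using (here; there)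
open import Data.Product.Base using (_,_; ∃-syntax)
open import Data.Sum.Base using (inj₁; inj₂)
open import Function.Base using (id; _∘_)
open import Relation.Binary.PropositionalEquality.Core using (refl)
open import Relation.Nullary.Decidable.Core using (yes; no)
open import Relation.Nullary.Negation.Core using (contradiction)

open import Defs

private variable
  A B φ ψ θ χ   : Formula
  Γ Δ Ξ Θ Σ Π Φ : List Formula

-- A sequent calculus over sets.

infix 3 _⊩_

data _⊩_ (Γ Δ : List Formula) : Set
data Right : Formula → List Formula → List Formula → Set
data Left  : Formula → List Formula → List Formula → Set

data _⊩_ Γ Δ where
  init  : A ∈ Γ → A ∈ Δ → Γ ⊩ Δ
  right : A ∈ Δ → Right A Γ Δ → Γ ⊩ Δ
  left  : A ∈ Γ → Left A Γ Δ → Γ ⊩ Δ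

-- Right A Γ Δ and Left A Γ Δ hold the premisses of a rule whose principal
-- formula is A and whose conclusion is Γ ⇒ Δ; A itself need not occur there.
data Right where
  ¬R  : φ ∷ Γ ⊩ Δ → Right (¬ φ) Γ Δ
  ∧R  : Γ ⊩ φ ∷ Δ → Γ ⊩ ψ ∷ Δ → Right (φ ∧ ψ) Γ Δ
  ∨R  : Γ ⊩ φ ∷ ψ ∷ Δ → Right (φ ∨ ψ) Γ Δ
  ⊃R  : φ ∷ Γ ⊩ ψ ∷ Δ → Right (φ ⊃ ψ) Γ Δ
  𝟒   : Γ ^□ ⊩ [ φ ] → Right (□ φ) Γ Δ
  Mon : 𝒪[ φ / ψ ] ∈ Γ →
        φ ∷ Γ ^□ ⊩ [ θ ] → ψ ∷ Γ ^□ ⊩ [ χ ] → χ ∷ Γ ^□ ⊩ [ ψ ] →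
        Right 𝒪[ θ / χ ] Γ Δ

data Left where
  ⊥L : Left ⊥ Γ Δ
  ¬L : Γ ⊩ φ ∷ Δ → Left (¬ φ) Γ Δ
  ∧L : φ ∷ ψ ∷ Γ ⊩ Δ → Left (φ ∧ ψ) Γ Δ
  ∨L : φ ∷ Γ ⊩ Δ → ψ ∷ Γ ⊩ Δ → Left (φ ∨ ψ) Γ Δ
  ⊃L : Γ ⊩ φ ∷ Δ → ψ ∷ Γ ⊩ Δ → Left (φ ⊃ ψ) Γ Δ
  T  : φ ∷ Γ ⊩ Δ → Left (□ φ) Γ Δ
  D₁ : φ ∷ Γ ^□ ⊩ [] → Left 𝒪[ φ / ψ ] Γ Δ
  D₂ : 𝒪[ θ / χ ] ∈ Γ →
       φ ∷ θ ∷ Γ ^□ ⊩ [] → ψ ∷ Γ ^□ ⊩ [ χ ] → χ ∷ Γ ^□ ⊩ [ ψ ] →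
       Left 𝒪[ φ / ψ ] Γ Δ

-- Monotonicity.

^□⁺ : Γ ⊆ Ξ → Γ ^□ ⊆ Ξ ^□
^□⁺ = filter⁺′ boxed? boxed? id

-- Lets the premiss of a `𝟒` serve again for a `𝟒` placed inside a boxed context.
^□-idem : ∀ Γ → Γ ^□ ⊆ (Γ ^□) ^□
^□-idem Γ x with ∈-filter⁻ boxed? {xs = Γ} x
... | _ , b = ∈-filter⁺ boxed? x b

⊩-mono     : Γ ⊆ Ξ → Δ ⊆ Θ → Γ ⊩ Δ → Ξ ⊩ Θ
Right-mono : Γ ⊆ Ξ → Δ ⊆ Θ → Right A Γ Δ → Right A Ξ Θ
Left-mono  : Γ ⊆ Ξ → Δ ⊆ Θ → Left A Γ Δ → Left A Ξ Θ

⊩-mono σ τ (init x y)  = init (σ x) (τ y)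
⊩-mono σ τ (right x r) = right (τ x) (Right-mono σ τ r)
⊩-mono σ τ (left x l)  = left (σ x) (Left-mono σ τ l)

Right-mono σ τ (¬R d)   = ¬R (⊩-mono (∷⁺ʳ _ σ) τ d)
Right-mono σ τ (∧R d e) = ∧R (⊩-mono σ (∷⁺ʳ _ τ) d) (⊩-mono σ (∷⁺ʳ _ τ) e)
Right-mono σ τ (∨R d)   = ∨R (⊩-mono σ (∷⁺ʳ _ (∷⁺ʳ _ τ)) d)
Right-mono σ τ (⊃R d)   = ⊃R (⊩-mono (∷⁺ʳ _ σ) (∷⁺ʳ _ τ) d)
Right-mono σ τ (𝟒 d)    = 𝟒 (⊩-mono (^□⁺ σ) id d)
Right-mono σ τ (Mon x d e f) =
  Mon (σ x) (⊩-mono (∷⁺ʳ _ (^□⁺ σ)) id d)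
            (⊩-mono (∷⁺ʳ _ (^□⁺ σ)) id e)
            (⊩-mono (∷⁺ʳ _ (^□⁺ σ)) id f)

Left-mono σ τ ⊥L       = ⊥L
Left-mono σ τ (¬L d)   = ¬L (⊩-mono σ (∷⁺ʳ _ τ) d)
Left-mono σ τ (∧L d)   = ∧L (⊩-mono (∷⁺ʳ _ (∷⁺ʳ _ σ)) τ d)
Left-mono σ τ (∨L d e) = ∨L (⊩-mono (∷⁺ʳ _ σ) τ d) (⊩-mono (∷⁺ʳ _ σ) τ e)
Left-mono σ τ (⊃L d e) = ⊃L (⊩-mono σ (∷⁺ʳ _ τ) d) (⊩-mono (∷⁺ʳ _ σ) τ e)
Left-mono σ τ (T d)    = T (⊩-mono (∷⁺ʳ _ σ) τ d)
Left-mono σ τ (D₁ d)   = D₁ (⊩-mono (∷⁺ʳ _ (^□⁺ σ)) id d)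
Left-mono σ τ (D₂ x d e f) =
  D₂ (σ x) (⊩-mono (∷⁺ʳ _ (∷⁺ʳ _ (^□⁺ σ))) id d)
           (⊩-mono (∷⁺ʳ _ (^□⁺ σ)) id e)
           (⊩-mono (∷⁺ʳ _ (^□⁺ σ)) id f)

⊩-weaken₂L : A ∷ Ξ ⊩ Θ → A ∷ B ∷ Ξ ⊩ Θ
⊩-weaken₂L = ⊩-mono (∷⁺ʳ _ there) id

⊩-weakenR : Ξ ⊩ Θ → Ξ ⊩ B ∷ Θ
⊩-weakenR = ⊩-mono id there

Right-weakenL : Right A Ξ Θ → Right A (B ∷ Ξ) Θ
Right-weakenL = Right-mono there id

Right-weakenR : Right A Ξ Θ → Right A Ξ (B ∷ Θ)
Right-weakenR = Right-mono id there

-- Cut over sets.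

exchange : ∀ A B → A ∷ B ∷ Γ ⊆ B ∷ A ∷ Γ
exchange A B = ∈-resp-↭ (↭-swap A B ↭-refl)

lift : ∀ B → Γ ⊆ A ∷ Ξ → B ∷ Γ ⊆ A ∷ B ∷ Ξ
lift B σ = exchange B _ ∘ ∷⁺ʳ B σ

-- The inclusions absorb every change of context, so the left derivation is only taken apart while
-- the right one may be weakened freely. `elim` returns to `cut⊩` only at proper subformulae of `A`.
cut⊩     : ∀ A → Γ ⊩ Δ → A ∷ Ξ ⊩ Θ → Γ ⊆ Ξ → Δ ⊆ A ∷ Θ → Ξ ⊩ Θ
cutRight : ∀ A → Right B Γ Δ → A ∷ Ξ ⊩ Θ → Γ ⊆ Ξ → Δ ⊆ A ∷ Θ → Right B Ξ Θ
cutLeft  : ∀ A → Left B Γ Δ → A ∷ Ξ ⊩ Θ → Γ ⊆ Ξ → Δ ⊆ A ∷ Θ → Left B Ξ Θ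

-- Right A Ξ Θ, unlike a derivation, can be carried into the boxed context of a
-- modal premiss, since only Ξ ^□ enters the premiss of 𝟒.
elim      : ∀ A → Right A Ξ Θ → Γ ⊩ Δ → Γ ⊆ A ∷ Ξ → Δ ⊆ Θ → Ξ ⊩ Θ
elimRight : ∀ A → Right A Ξ Θ → Right B Γ Δ → Γ ⊆ A ∷ Ξ → Δ ⊆ Θ → Right B Ξ Θ
elimLeft  : ∀ A → Right A Ξ Θ → Left B Γ Δ → Γ ⊆ A ∷ Ξ → Δ ⊆ Θ → Left B Ξ Θ
-- Φ collects the formulae a modal rule adds to the boxed part of its context.
elim□     : ∀ A Φ → Right A Ξ Θ → Φ ++ Γ ^□ ⊩ Δ → Γ ⊆ A ∷ Ξ → Φ ++ Ξ ^□ ⊩ Δ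

reduce    : ∀ A → Right A Ξ Θ → Left A Ξ Θ → Ξ ⊩ Θ
-- The shape of the cuts left by modal rules, whose left premiss has only the cut formula in its
-- succedent.
compose   : ∀ A → Γ ⊩ [ A ] → A ∷ Σ ⊩ Π → Γ ⊆ Ξ → Σ ⊆ Ξ → Ξ ⊩ Π

cut⊩ A (init x y) e σ τ with τ y
... | here refl = ⊩-mono (∈-∷⁺ʳ (σ x) id) id e
... | there y′  = init (σ x) y′
cut⊩ A (right x r) e σ τ with τ x
... | here refl = elim A (cutRight A r e σ τ) e id id
... | there x′  = right x′ (cutRight A r e σ τ)
cut⊩ A (left x l) e σ τ = left (σ x) (cutLeft A l e σ τ)

cutRight A (¬R d) e σ τ   = ¬R (cut⊩ A d (⊩-weaken₂L e) (∷⁺ʳ _ σ) τ)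
cutRight A (∧R d f) e σ τ = ∧R (cut⊩ A d (⊩-weakenR e) σ (lift _ τ))
                               (cut⊩ A f (⊩-weakenR e) σ (lift _ τ))
cutRight A (∨R d) e σ τ   = ∨R (cut⊩ A d (⊩-weakenR (⊩-weakenR e)) σ (lift _ (lift _ τ)))
cutRight A (⊃R d) e σ τ   = ⊃R (cut⊩ A d (⊩-weaken₂L (⊩-weakenR e)) (∷⁺ʳ _ σ) (lift _ τ))
-- The premisses of `𝟒` and `Mon` forget `Δ`, so the same rule concludes with `Θ` directly and the
-- cut disappears.
cutRight A (𝟒 d) e σ τ    = Right-mono σ id (𝟒 d)
cutRight A (Mon x d₁ d₂ d₃) e σ τ = Right-mono σ id (Mon x d₁ d₂ d₃)

cutLeft A ⊥L e σ τ       = ⊥L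
cutLeft A (¬L d) e σ τ   = ¬L (cut⊩ A d (⊩-weakenR e) σ (lift _ τ))
cutLeft A (∧L d) e σ τ   = ∧L (cut⊩ A d (⊩-weaken₂L (⊩-weaken₂L e)) (∷⁺ʳ _ (∷⁺ʳ _ σ)) τ)
cutLeft A (∨L d f) e σ τ = ∨L (cut⊩ A d (⊩-weaken₂L e) (∷⁺ʳ _ σ) τ)
                              (cut⊩ A f (⊩-weaken₂L e) (∷⁺ʳ _ σ) τ)
cutLeft A (⊃L d f) e σ τ = ⊃L (cut⊩ A d (⊩-weakenR e) σ (lift _ τ))
                              (cut⊩ A f (⊩-weaken₂L e) (∷⁺ʳ _ σ) τ)
cutLeft A (T d) e σ τ    = T (cut⊩ A d (⊩-weaken₂L e) (∷⁺ʳ _ σ) τ)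
cutLeft A (D₁ d) e σ τ   = Left-mono σ id (D₁ d)
cutLeft A (D₂ x d₁ d₂ d₃) e σ τ = Left-mono σ id (D₂ x d₁ d₂ d₃)

elim A i (init x y) σ τ with σ x
-- The axiom is on `A`, so `A` lies in `Θ` and the step `i` introduces it there.
... | here refl = right (τ y) i
... | there x′  = init x′ (τ y)
elim A i (right x r) σ τ = right (τ x) (elimRight A i r σ τ)
elim A i (left x l) σ τ with σ x
... | here refl = reduce A i (elimLeft A i l σ τ)
... | there x′  = left x′ (elimLeft A i l σ τ)

elimRight A i (¬R d) σ τ   = ¬R (elim A (Right-weakenL i) d (lift _ σ) τ)
elimRight A i (∧R d e) σ τ = ∧R (elim A (Right-weakenR i) d σ (∷⁺ʳ _ τ))
                                (elim A (Right-weakenR i) e σ (∷⁺ʳ _ τ))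
elimRight A i (∨R d) σ τ   =
  ∨R (elim A (Right-weakenR (Right-weakenR i)) d σ (∷⁺ʳ _ (∷⁺ʳ _ τ)))
elimRight A i (⊃R d) σ τ   =
  ⊃R (elim A (Right-weakenL (Right-weakenR i)) d (lift _ σ) (∷⁺ʳ _ τ))
elimRight A i (𝟒 d) σ τ    = 𝟒 (elim□ A [] i d σ)
elimRight A i (Mon x d e f) σ τ
  with σ x | elim□ A [ _ ] i d σ | elim□ A [ _ ] i e σ | elim□ A [ _ ] i f σ
... | there x′  | d′ | e′ | f′ = Mon x′ d′ e′ f′
-- Two `Mon` steps fuse into one: `φ` links the obligations, and `ψ` links the conditions in both
-- directions.
elimRight 𝒪[ φ / ψ ] (Mon y d₀ e₀ f₀) (Mon x d e f) σ τ
    | here refl | d′ | e′ | f′ =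
  Mon y (compose φ d₀ d′ id there)
        (compose ψ e₀ e′ id there)
        (compose ψ f′ f₀ id there)

elimLeft A i ⊥L σ τ       = ⊥L
elimLeft A i (¬L d) σ τ   = ¬L (elim A (Right-weakenR i) d σ (∷⁺ʳ _ τ))
elimLeft A i (∧L d) σ τ   =
  ∧L (elim A (Right-weakenL (Right-weakenL i)) d (lift _ (lift _ σ)) τ)
elimLeft A i (∨L d e) σ τ = ∨L (elim A (Right-weakenL i) d (lift _ σ) τ)
                               (elim A (Right-weakenL i) e (lift _ σ) τ)
elimLeft A i (⊃L d e) σ τ = ⊃L (elim A (Right-weakenR i) d σ (∷⁺ʳ _ τ))
                               (elim A (Right-weakenL i) e (lift _ σ) τ)
elimLeft A i (T d) σ τ    = T (elim A (Right-weakenL i) d (lift _ σ) τ)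
elimLeft A i (D₁ d) σ τ   = D₁ (elim□ A [ _ ] i d σ)
elimLeft A i (D₂ x d e f) σ τ
  with σ x | elim□ A (_ ∷ _ ∷ []) i d σ | elim□ A [ _ ] i e σ | elim□ A [ _ ] i f σ
... | there x′  | d′ | e′ | f′ = D₂ x′ d′ e′ f′
-- The cut formula is the second principal formula of D₂ (the first is left to reduce).
elimLeft 𝒪[ θ / χ ] (Mon y d₀ e₀ f₀) (D₂ x d e f) σ τ
    | here refl | d′ | e′ | f′ =
  D₂ y (compose θ d₀ (⊩-mono (exchange _ θ) id d′)
          there (∷⁺ʳ _ there))
       (compose χ e′ f₀ id there)
       (compose χ e₀ f′ id there)

elim□ A Φ i d σ with boxed? A
elim□ {Ξ = Ξ} A Φ (𝟒 d₀) d σ | yes (boxed φ) =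
  elim (□ φ) (𝟒 (⊩-mono (^□⁺ (xs⊆ys++xs _ Φ) ∘ ^□-idem Ξ) id d₀)) d
       (∈-resp-↭ (shift (□ φ) Φ _) ∘ ++⁺ʳ Φ (^□⁺ σ)) id
-- An unboxed cut formula is erased by `^□`, so weakening suffices.
elim□ {Ξ = Ξ} {Γ = Γ} A Φ i d σ | no ¬b = ⊩-mono (++⁺ʳ Φ discard) id d
  where
  discard : Γ ^□ ⊆ Ξ ^□
  discard x with ∈-filter⁻ boxed? {xs = Γ} x
  ... | x∈Γ , b with σ x∈Γ
  ... | here refl = contradiction b ¬b
  ... | there x∈Ξ = ∈-filter⁺ boxed? x∈Ξ b

reduce (¬ φ) (¬R d) (¬L e) = cut⊩ φ e d id id
reduce (φ ∧ ψ) (∧R d e) (∧L f) = cut⊩ φ d (cut⊩ ψ e f′ there id) id id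
  where f′ = ⊩-mono (exchange φ ψ) id f
reduce (φ ∨ ψ) (∨R d) (∨L e f) = cut⊩ ψ (cut⊩ φ d (⊩-weakenR e) id id) f id id
reduce (φ ⊃ ψ) (⊃R d) (⊃L e f) = cut⊩ ψ (cut⊩ φ e d id (∷⁺ʳ φ there)) f id id
reduce (□ φ) (𝟒 d) (T e) = compose φ d e (filter-⊆ boxed? _) id
-- A `Mon` cut against `D₁` or `D₂` becomes that same rule, applied to the left principal formula of
-- `Mon`.
reduce 𝒪[ θ / χ ] (Mon x d e f) (D₁ g) = left x (D₁ (compose θ d g id there))
reduce 𝒪[ θ / χ ] (Mon x d e f) (D₂ y g h k) =
  left x (D₂ y (compose θ d g (∷⁺ʳ _ there) there)
               (compose χ e h id there)
               (compose χ k f id there))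

compose A d e σ τ = cut⊩ A d (⊩-mono (∷⁺ʳ A τ) id e) σ (∈-∷⁺ʳ (here refl) λ ())

-- Equivalence of the two calculi.

weakenL : GbMDLConW ⊢ Γ ⇒ Δ → GbMDLConW ⊢ A ∷ Γ ⇒ Δ
weakenL {Γ} {Δ} {A} d =
  perm (++-comm Γ [ A ]) (↭-reflexive (++-identityʳ Δ))
       (rule (inj₂ (inj₂ (W {Σ = [ A ]} {Π = []}))) (d ∷ []))

weakenR : GbMDLConW ⊢ Γ ⇒ Δ → GbMDLConW ⊢ Γ ⇒ A ∷ Δ
weakenR {Γ} {Δ} {A} d =
  perm (↭-reflexive (++-identityʳ Γ)) (++-comm Δ [ A ])
       (rule (inj₂ (inj₂ (W {Σ = []} {Π = [ A ]}))) (d ∷ []))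

∈⇒↭ : A ∈ Γ → ∃[ Γ′ ] Γ ↭ A ∷ Γ′
∈⇒↭ {A} x with Γ₁ , Γ₂ , refl ← ∈-∃++ x = Γ₁ ++ Γ₂ , shift A Γ₁ Γ₂

contractL : A ∈ Γ → GbMDLConW ⊢ A ∷ Γ ⇒ Δ → GbMDLConW ⊢ Γ ⇒ Δ
contractL x d with _ , p ← ∈⇒↭ x =
  perm (↭-sym p) ↭-refl
       (rule (inj₂ (inj₁ ConL)) (perm (prep _ p) ↭-refl d ∷ []))

contractR : A ∈ Δ → GbMDLConW ⊢ Γ ⇒ A ∷ Δ → GbMDLConW ⊢ Γ ⇒ Δ
contractR x d with _ , p ← ∈⇒↭ x =
  perm ↭-refl (↭-sym p)
       (rule (inj₂ (inj₁ ConR)) (perm ↭-refl (prep _ p) d ∷ []))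

-- Each rule acts on a fresh copy of its principal formula, which contraction merges with the
-- occurrence in the context. Weakening supplies the copy that propositional rules and `T` keep in
-- their premisses.
⊩⇒⊢ : Γ ⊩ Δ → GbMDLConW ⊢ Γ ⇒ Δ
⊩⇒⊢ (init x y) = contractL x (contractR y (rule (inj₁ init) []))
⊩⇒⊢ (right x (¬R d)) =
  contractR x (rule (inj₁ ¬R) (weakenR (⊩⇒⊢ d) ∷ []))
⊩⇒⊢ (right x (∧R d e)) =
  contractR x (rule (inj₁ ∧R) (weakenR (⊩⇒⊢ d) ∷ weakenR (⊩⇒⊢ e) ∷ []))
⊩⇒⊢ (right x (∨R d)) =
  contractR x (rule (inj₁ ∨R) (weakenR (⊩⇒⊢ d) ∷ []))
⊩⇒⊢ (right x (⊃R d)) =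
  contractR x (rule (inj₁ ⊃R) (weakenR (⊩⇒⊢ d) ∷ []))
⊩⇒⊢ (right x (𝟒 d)) =
  contractR x (rule (inj₁ 𝟒) (⊩⇒⊢ d ∷ []))
⊩⇒⊢ (right x (Mon y d e f)) =
  contractL y (contractR x (rule (inj₁ Mon) (⊩⇒⊢ d ∷ ⊩⇒⊢ e ∷ ⊩⇒⊢ f ∷ [])))
⊩⇒⊢ (left x ⊥L) = contractL x (rule (inj₁ ⊥L) [])
⊩⇒⊢ (left x (¬L d)) =
  contractL x (rule (inj₁ ¬L) (weakenL (⊩⇒⊢ d) ∷ []))
⊩⇒⊢ (left x (∧L d)) =
  contractL x (rule (inj₁ ∧L) (weakenL (⊩⇒⊢ d) ∷ []))
⊩⇒⊢ (left x (∨L d e)) =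
  contractL x (rule (inj₁ ∨L) (weakenL (⊩⇒⊢ d) ∷ weakenL (⊩⇒⊢ e) ∷ []))
⊩⇒⊢ (left x (⊃L d e)) =
  contractL x (rule (inj₁ ⊃L) (weakenL (⊩⇒⊢ d) ∷ weakenL (⊩⇒⊢ e) ∷ []))
⊩⇒⊢ (left x (T d)) =
  contractL x (rule (inj₁ T) (weakenL (⊩⇒⊢ d) ∷ []))
⊩⇒⊢ (left x (D₁ d)) =
  contractL x (rule (inj₁ D₁) (⊩⇒⊢ d ∷ []))
⊩⇒⊢ (left x (D₂ y d e f)) =
  contractL y (contractL (there x)
    (rule (inj₁ D₂) (⊩⇒⊢ d ∷ ⊩⇒⊢ e ∷ ⊩⇒⊢ f ∷ [])))

pattern 0th = here refl

-- Contexts of `⊩` retain the principal formula, which matches the copied one up to order; `perm`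
-- and the structural rules are instances of `⊩-mono`.
⊢⇒⊩ : GbMDLConW ⊢ Γ ⇒ Δ → Γ ⊩ Δ
⊢⇒⊩ (perm p q d) = ⊩-mono (∈-resp-↭ p) (∈-resp-↭ q) (⊢⇒⊩ d)
⊢⇒⊩ (rule (inj₁ init) []) = init 0th 0th
⊢⇒⊩ (rule (inj₁ ⊥L) []) = left 0th ⊥L
⊢⇒⊩ (rule (inj₁ ¬L) (d ∷ [])) = left 0th (¬L (⊢⇒⊩ d))
⊢⇒⊩ (rule (inj₁ ¬R) (d ∷ [])) = right 0th (¬R (⊢⇒⊩ d))
⊢⇒⊩ (rule (inj₁ ∧L) (d ∷ [])) =
  left 0th (∧L (⊩-mono (∈-∷⁺ʳ (there (there 0th)) (∷⁺ʳ _ (∷⁺ʳ _ there))) id (⊢⇒⊩ d)))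
⊢⇒⊩ (rule (inj₁ ∧R) (d ∷ e ∷ [])) =
  right 0th (∧R (⊩-mono id (exchange _ _) (⊢⇒⊩ d)) (⊩-mono id (exchange _ _) (⊢⇒⊩ e)))
⊢⇒⊩ (rule (inj₁ ∨L) (d ∷ e ∷ [])) =
  left 0th (∨L (⊩-mono (exchange _ _) id (⊢⇒⊩ d)) (⊩-mono (exchange _ _) id (⊢⇒⊩ e)))
⊢⇒⊩ (rule (inj₁ ∨R) (d ∷ [])) =
  right 0th (∨R (⊩-mono id (∈-∷⁺ʳ (there (there 0th)) (∷⁺ʳ _ (∷⁺ʳ _ there))) (⊢⇒⊩ d)))
⊢⇒⊩ (rule (inj₁ ⊃L) (d ∷ e ∷ [])) =
  left 0th (⊃L (⊢⇒⊩ d) (⊩-mono (exchange _ _) id (⊢⇒⊩ e)))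
⊢⇒⊩ (rule (inj₁ ⊃R) (d ∷ [])) =
  right 0th (⊃R (⊩-mono id (exchange _ _) (⊢⇒⊩ d)))
⊢⇒⊩ (rule (inj₁ 𝟒) (d ∷ [])) = right 0th (𝟒 (⊢⇒⊩ d))
⊢⇒⊩ (rule (inj₁ T) (d ∷ [])) =
  left 0th (T (⊩-mono (exchange _ _) id (⊢⇒⊩ d)))
-- The obligation heading the antecedent is removed by `^□` definitionally, so the premisses carry
-- over as they are.
⊢⇒⊩ (rule (inj₁ Mon) (d ∷ e ∷ f ∷ [])) =
  right 0th (Mon 0th (⊢⇒⊩ d) (⊢⇒⊩ e) (⊢⇒⊩ f))
⊢⇒⊩ (rule (inj₁ D₁) (d ∷ [])) = left 0th (D₁ (⊢⇒⊩ d))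
⊢⇒⊩ (rule (inj₁ D₂) (d ∷ e ∷ f ∷ [])) =
  left 0th (D₂ (there 0th) (⊢⇒⊩ d) (⊢⇒⊩ e) (⊢⇒⊩ f))
⊢⇒⊩ (rule (inj₂ (inj₁ ConL)) (d ∷ [])) = ⊩-mono (∈-∷⁺ʳ 0th id) id (⊢⇒⊩ d)
⊢⇒⊩ (rule (inj₂ (inj₁ ConR)) (d ∷ [])) = ⊩-mono id (∈-∷⁺ʳ 0th id) (⊢⇒⊩ d)
⊢⇒⊩ (rule (inj₂ (inj₂ W)) (d ∷ [])) =
  ⊩-mono (xs⊆xs++ys _ _) (xs⊆xs++ys _ _) (⊢⇒⊩ d)

theorem1 : Admissible Cut GbMDLConW
theorem1 (cut {Γ} {Δ} {Σ} {Π} {φ}) (d ∷ e ∷ []) =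
  ⊩⇒⊢ (cut⊩ φ (⊢⇒⊩ d)
    (⊩-mono (∷⁺ʳ φ (xs⊆ys++xs Σ Γ)) (xs⊆ys++xs Π Δ) (⊢⇒⊩ e))
    (xs⊆xs++ys Γ Σ) (∷⁺ʳ φ (xs⊆xs++ys Δ Π)))
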